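{- The maps $\mathcal I_1: Form_{RatLuk}\to Form_{\mathcal Q}$ and $\mathcal I_2: Form_{\mathcal Q}\to Form_{RatLuk}$ define two faithful translations of one logic into the other: for every $\varphi\in Form_{RatLuk}$, $\varphi$ is a theorem of Rational Łukasiewicz logic if and only if $\mathcal I_1(\varphi)$ is a theorem of $\mathcal Q$Ł, and for every $\psi\in Form_{\mathcal Q}$, $\psi$ is a theorem of $\mathcal Q$Ł if and only if $\mathcal I_2(\psi)$ is a theorem of Rational Łukasiewicz logic.
   Context: Let $[0,1]_{\mathbb Q}=[0,1]\cap\mathbb Q$, with $r\odot q^*=\max\{0,r-q\}$. Łukasiewicz logic has primitive connectives $\neg,\to$; put $\varphi\oplus\psi:=\neg\varphi\to\psi$ and $\varphi\vee\psi:=(\varphi\to\psi)\to\psi$. Its axioms are (L1) $\varphi\to(\psi\to\varphi)$; (L2) $(\varphi\to\psi)\to((\psi\to\chi)\to(\varphi\to\chi))$; (L3) $(\varphi\vee\psi)\to(\psi\vee\varphi)$; (L4) $(\neg\psi\to\neg\varphi)\to(\varphi\to\psi)$. The logic $\mathcal Q$Ł (formulas $Form_{\mathcal Q}$) adds to Łukasiewicz logic a unary connective $\nabla_r$ for each $r\in[0,1]_{\mathbb Q}$. Its axioms are (L1)–(L4) together with (Q1) $\nabla_r(\varphi\to\psi)\leftrightarrow(\nabla_r\varphi\to\nabla_r\psi)$; (Q2) $\nabla_{(r\odot q^*)}\varphi\leftrightarrow(\nabla_q\varphi\to\nabla_r\varphi)$; (Q3) $\nabla_r(\nabla_q\varphi)\leftrightarrow\nabla_{r\cdot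 q}\varphi$; (Q4) $\nabla_1\varphi\leftrightarrow\varphi$ (each $\leftrightarrow$ stands for both implications). The only rule is modus ponens. Put $\Delta_r:=\neg\nabla_r\neg$; for the translations, formulas of $\mathcal Q$Ł are regarded as built with $\Delta_r$ as the primitive connective (so $\nabla_r=\neg\Delta_r\neg$). Rational Łukasiewicz logic (formulas $Form_{RatLuk}$) adds to Łukasiewicz logic unary connectives $\delta_n$, $n\ge1$. Its axioms are (L1)–(L4) together with (D1) $n(\delta_n\varphi)\to\varphi$; (D2) $\varphi\to n(\delta_n\varphi)$; (D3) $\neg\delta_n\varphi\oplus\neg((n-1)\delta_n\varphi)$, where $k\theta$ denotes $\theta\oplus\dots\oplus\theta$ ($k$ times), and the empty sum ($k=0$) is a falsum formula $\neg(p\to p)$. The only rule is modus ponens. Translations: $\mathcal I_1$ and $\mathcal I_2$ are the identity on propositional variables and commute with $\neg$ and $\to$; moreover $\mathcal I_1(\delta_n\varphi)=\Delta_{\frac1n}\mathcal I_1(\varphi)$, and, for $r=\frac mn$ (a fixed fractional representation with $0\le m\le n$, $n\ge1$), $\mathcal I_2(\Delta_r\varphi)=m\,(\delta_n\mathcal I_2(\varphi))$. -}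

module Defs where

open import Data.Integer.Base as ℤ using (+_)
open import Data.Nat.Base as ℕ using (ℕ; zero; suc; NonZero; _∸_)
open import Data.Rational.Base
  using (ℚ; 0ℚ; 1ℚ; _/_; _⊔_; _-_; _*_; _≤_; *≤*; nonNegative)
import Data.Rational.Properties as ℚₚ
import Data.Rational.Unnormalised.Base as ℚᵘ
import Data.Rational.Unnormalised.Properties as ℚᵘₚ
open import Relation.Binary.PropositionalEquality using (_≡_; subst)

-- The bounds are irrelevant, so elements with the same value are equal.
record [0,1]ℚ : Set where
  constructor unit
  field
    value  : ℚ
    .lower : 0ℚ ≤ value
    .upper : value ≤ 1ℚ

open [0,1]ℚ public

0≤1 : 0ℚ ≤ 1ℚ
0≤1 = *≤* (ℤ.+≤+ ℕ.z≤n)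

1ᵘ : [0,1]ℚ
1ᵘ = unit 1ℚ 0≤1 ℚₚ.≤-refl

infixl 7 _·_ _⊙_*

_·_ : [0,1]ℚ → [0,1]ℚ → [0,1]ℚ
unit r 0≤r r≤1 · unit q 0≤q q≤1 = unit (r * q) (0≤rq 0≤r 0≤q) (rq≤1 r≤1 0≤q q≤1)
  where
  0≤rq : 0ℚ ≤ r → 0ℚ ≤ q → 0ℚ ≤ r * q
  0≤rq 0≤r 0≤q = subst (_≤ r * q) (ℚₚ.*-zeroˡ q)
    (ℚₚ.*-monoʳ-≤-nonNeg q {{nonNegative 0≤q}} 0≤r)

  rq≤1 : r ≤ 1ℚ → 0ℚ ≤ q → q ≤ 1ℚ → r * q ≤ 1ℚ
  rq≤1 r≤1 0≤q q≤1 = ℚₚ.≤-trans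
    (subst (r * q ≤_) (ℚₚ.*-identityˡ q)
      (ℚₚ.*-monoʳ-≤-nonNeg q {{nonNegative 0≤q}} r≤1))
    q≤1

_⊙_* : [0,1]ℚ → [0,1]ℚ → [0,1]ℚ
unit r 0≤r r≤1 ⊙ unit q 0≤q q≤1 * =
  unit (0ℚ ⊔ (r - q)) (ℚₚ.p≤p⊔q 0ℚ (r - q)) (ub r≤1 0≤q)
  where
  ub : r ≤ 1ℚ → 0ℚ ≤ q → 0ℚ ⊔ (r - q) ≤ 1ℚ
  ub r≤1 0≤q = ℚₚ.⊔-lub {1ℚ} {0ℚ} {r - q} 0≤1
    (subst (r - q ≤_) (ℚₚ.+-identityʳ 1ℚ)
      (ℚₚ.+-mono-≤ r≤1 (ℚₚ.neg-antimono-≤ 0≤q)))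

1/ₙ_ : (n : ℕ) → .{{NonZero n}} → [0,1]ℚ
1/ₙ n = unit (+ 1 / n) (ℚₚ.nonNegative⁻¹ (+ 1 / n) {{ℚₚ.normalize-nonNeg 1 n}}) (ub n)
  where
  ub : ∀ n .{{_ : NonZero n}} → + 1 / n ≤ 1ℚ
  ub (suc k) = ℚₚ.toℚᵘ-cancel-≤ (ℚᵘₚ.≤-trans
    (ℚᵘₚ.≤-reflexive (ℚₚ.toℚᵘ-fromℚᵘ (ℚᵘ.mkℚᵘ (+ 1) k)))
    (ℚᵘ.*≤* (ℤ.+≤+ (ℕ.s≤s ℕ.z≤n))))

-- A choice, for each r in [0,1]ℚ, of a fraction m / n representing it,
-- not necessarily in lowest terms.
record Representation : Set where
  field
    num         : [0,1]ℚ → ℕ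
    den         : [0,1]ℚ → ℕ
    {{den≢0}}   : ∀ {r} → NonZero (den r)
    num≤den     : ∀ r → num r ℕ.≤ den r
    represents  : ∀ r → + num r / den r ≡ value r

infixr 5 _⇒_
infix  9 ~_

data Form (Op : Set) : Set where
  var : ℕ → Form Op
  ~_  : Form Op → Form Op
  _⇒_ : Form Op → Form Op → Form Op
  op  : Op → Form Op → Form Op

module _ {Op : Set} where

  infixr 6 _⊕_ _∨_
  infixr 8 _•_

  _⊕_ _∨_ : Form Op → Form Op → Form Op
  φ ⊕ ψ = ~ φ ⇒ ψ
  φ ∨ ψ = (φ ⇒ ψ) ⇒ ψ

  falsum : Form Op
  falsum = ~ (var 0 ⇒ var 0)

  -- Sums associate to the right; the one-fold sum is θ itself, not θ ⊕ falsum.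
  _•_ : ℕ → Form Op → Form Op
  0           • θ = falsum
  1           • θ = θ
  suc (suc k) • θ = θ ⊕ (suc k • θ)

  data Theorem (Axiom : Form Op → Set) : Form Op → Set where
    L1 : ∀ φ ψ → Theorem Axiom (φ ⇒ (ψ ⇒ φ))
    L2 : ∀ φ ψ χ → Theorem Axiom ((φ ⇒ ψ) ⇒ ((ψ ⇒ χ) ⇒ (φ ⇒ χ)))
    L3 : ∀ φ ψ → Theorem Axiom ((φ ∨ ψ) ⇒ (ψ ∨ φ))
    L4 : ∀ φ ψ → Theorem Axiom ((~ ψ ⇒ ~ φ) ⇒ (φ ⇒ ψ))
    ax : ∀ {φ} → Axiom φ → Theorem Axiom φ
    mp : ∀ {φ ψ} → Theorem Axiom φ → Theorem Axiom (φ ⇒ ψ) → Theorem Axiom ψ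

translate : {Op Op′ : Set} → (Op → Form Op′ → Form Op′) → Form Op → Form Op′
translate f (var i)  = var i
translate f (~ φ)    = ~ translate f φ
translate f (φ ⇒ ψ)  = translate f φ ⇒ translate f ψ
translate f (op o φ) = f o (translate f φ)

data ∇Op : Set where
  nabla : [0,1]ℚ → ∇Op

Form𝒬 : Set
Form𝒬 = Form ∇Op

∇ Δ : [0,1]ℚ → Form𝒬 → Form𝒬
∇ r φ = op (nabla r) φ
Δ r φ = ~ ∇ r (~ φ)

data Axiom𝒬 : Form𝒬 → Set where
  Q1→ : ∀ r φ ψ → Axiom𝒬 (∇ r (φ ⇒ ψ) ⇒ (∇ r φ ⇒ ∇ r ψ))
  Q1← : ∀ r φ ψ → Axiom𝒬 ((∇ r φ ⇒ ∇ r ψ) ⇒ ∇ r (φ ⇒ ψ))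
  Q2→ : ∀ r q φ → Axiom𝒬 (∇ (r ⊙ q *) φ ⇒ (∇ q φ ⇒ ∇ r φ))
  Q2← : ∀ r q φ → Axiom𝒬 ((∇ q φ ⇒ ∇ r φ) ⇒ ∇ (r ⊙ q *) φ)
  Q3→ : ∀ r q φ → Axiom𝒬 (∇ r (∇ q φ) ⇒ ∇ (r · q) φ)
  Q3← : ∀ r q φ → Axiom𝒬 (∇ (r · q) φ ⇒ ∇ r (∇ q φ))
  Q4→ : ∀ φ → Axiom𝒬 (∇ 1ᵘ φ ⇒ φ)
  Q4← : ∀ φ → Axiom𝒬 (φ ⇒ ∇ 1ᵘ φ)

infix 3 ⊢𝒬_ ⊢𝒬ᐞ_ ⊢Rat_

⊢𝒬_ : Form𝒬 → Set
⊢𝒬_ = Theorem Axiom𝒬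

-- The same logic presented with Δ instead of ∇ as primitive.  A formula of
-- this presentation is a theorem when it is one of 𝒬Ł after Δ is unfolded to
-- ~ ∇ ~.  Restating Q1-Q4 for ~ Δ ~ instead would be too weak: those axioms
-- would say nothing about Δ applied to a formula that is not a negation.

data ΔOp : Set where
  delta : [0,1]ℚ → ΔOp

Form𝒬ᐞ : Set
Form𝒬ᐞ = Form ΔOp

Δᐞ ∇ᐞ : [0,1]ℚ → Form𝒬ᐞ → Form𝒬ᐞ
Δᐞ r φ = op (delta r) φ
∇ᐞ r φ = ~ Δᐞ r (~ φ)

unfoldΔ : Form𝒬ᐞ → Form𝒬
unfoldΔ = translate λ { (delta r) → Δ r }

unfold∇ : Form𝒬 → Form𝒬ᐞ
unfold∇ = translate λ { (nabla r) → ∇ᐞ r }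

⊢𝒬ᐞ_ : Form𝒬ᐞ → Set
⊢𝒬ᐞ φ = ⊢𝒬 unfoldΔ φ

data δOp : Set where
  division : (n : ℕ) → .{{NonZero n}} → δOp

FormRat : Set
FormRat = Form δOp

δ : (n : ℕ) → .{{NonZero n}} → FormRat → FormRat
δ n φ = op (division n) φ

data AxiomRat : FormRat → Set where
  D1 : ∀ n .{{_ : NonZero n}} φ → AxiomRat (n • δ n φ ⇒ φ)
  D2 : ∀ n .{{_ : NonZero n}} φ → AxiomRat (φ ⇒ n • δ n φ)
  D3 : ∀ n .{{_ : NonZero n}} φ → AxiomRat (~ δ n φ ⊕ ~ ((n ∸ 1) • δ n φ))

⊢Rat_ : FormRat → Set
⊢Rat_ = Theorem AxiomRat

I₁ : FormRat → Form𝒬ᐞ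
I₁ = translate λ { (division n) → Δᐞ (1/ₙ n) }

module _ (rep : Representation) where
  open Representation rep

  I₂ : Form𝒬ᐞ → FormRat
  I₂ = translate λ { (delta r) φ → num r • δ (den r) φ }

{-# OPTIONS --safe #-}
module Submission where

open import Data.Integer.Base as ℤ using (+_)
import Data.Integer.Properties as ℤₚ
open import Data.Nat.Base
  using (ℕ; zero; suc; _+_; _*_; _≤_; _∸_; z≤n; s≤s; NonZero)
import Data.Nat.Properties as ℕₚ
open import Data.Product.Base using (_×_; _,_)
open import Data.Rational.Base as ℚ using (0ℚ; 1ℚ; _/_; _⊔_)
import Data.Rational.Properties as ℚₚ
open import Data.Rational.Unnormalised.Base as ℚᵘ using (mkℚᵘ; *≡*)
import Data.Rational.Unnormalised.Properties as ℚᵘₚ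
open import Data.Sum.Base using (inj₁; inj₂)
open import Defs
open import Function.Bundles using (_⇔_; mk⇔)
open import Relation.Binary.Bundles using (Setoid)
open import Relation.Binary.PropositionalEquality
  using (_≡_; refl; sym; trans; cong; cong₂; subst; subst₂; module ≡-Reasoning)
import Relation.Binary.Reasoning.Setoid as SetoidReasoning
open import Relation.Nullary.Decidable.Core using (recompute)

-- Each translation preserves theorems and, up to provable equivalence, the two
-- are mutually inverse; faithfulness follows.  Everything reduces to one fact of
-- Łukasiewicz logic: when n • φ is a sum without truncation, n • (φ ⊖ ψ) is
-- equivalent to n • φ ⊖ n • ψ, where φ ⊖ ψ = ~ (φ ⇒ ψ).  It holds if φ ⇒ ψ or
-- ψ ⇒ φ is added as an axiom, and by prelinearity this suffices.  It makes
-- division by n unique, hence δ n congruent and compatible with ⊖, and lets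
-- fractions m • δ n φ be brought to a common denominator.

-- Łukasiewicz logic over arbitrary additional axioms

module Łukasiewicz {Op : Set} (Ax : Form Op → Set) where

  private variable
    φ ψ χ θ φ′ ψ′ : Form Op

  infix 3 ⊢_
  infix 4 _⊑_ _⊥_ _≈_
  infixr 2 _⨾_

  ⊢_ : Form Op → Set
  ⊢_ = Theorem Ax

  -- In terms of values, `φ ⊥ ψ` says that the two add up to at most 1, so that `φ ⊕ ψ` is not
  -- truncated.
  _⊑_ _⊥_ : Form Op → Form Op → Set
  φ ⊑ ψ = ⊢ φ ⇒ ψ
  φ ⊥ ψ = φ ⊑ ~ ψ

  record _≈_ (φ ψ : Form Op) : Set where
    constructor _,_
    field
      to   : φ ⊑ ψ
      from : ψ ⊑ φ
  open _≈_ public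

  _⨾_ : φ ⊑ ψ → ψ ⊑ χ → φ ⊑ χ
  p ⨾ q = mp q (mp p (L2 _ _ _))

  -- L1 gives `φ ⊑ ψ ∨ φ`, and L3 commutes the disjunction.
  assertion : φ ⊑ (φ ⇒ ψ) ⇒ ψ
  assertion = L1 _ _ ⨾ L3 _ _

  ⇒-monoˡ : φ′ ⊑ φ → φ ⇒ ψ ⊑ φ′ ⇒ ψ
  ⇒-monoˡ p = mp p (L2 _ _ _)

  exchange : φ ⊑ ψ ⇒ χ → ψ ⊑ φ ⇒ χ
  exchange p = assertion ⨾ ⇒-monoˡ p

  ⇒-monoʳ : ψ ⊑ ψ′ → φ ⇒ ψ ⊑ φ ⇒ ψ′
  ⇒-monoʳ p = mp p (exchange (L2 _ _ _))

  ⊑-refl : φ ⊑ φ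
  ⊑-refl {φ} = mp (L1 φ φ) (exchange (L1 φ (φ ⇒ (φ ⇒ φ))))

  ⇒-swap : φ ⇒ ψ ⇒ χ ⊑ ψ ⇒ φ ⇒ χ
  ⇒-swap = L2 _ _ _ ⨾ ⇒-monoˡ assertion

  ~~-elim : ~ ~ φ ⊑ φ
  -- `L1 φ φ` serves as an arbitrary theorem `T`: two uses of L4 turn `~ ~ T ⇒ ~ ~ φ` into `T ⇒ φ`,
  -- and `exchange` brings `T` to the front, where it is discharged.
  ~~-elim {φ} = mp (L1 φ φ) (exchange (L1 _ _ ⨾ L4 _ _ ⨾ L4 _ _))

  ~~-intro : φ ⊑ ~ ~ φ
  ~~-intro = mp ~~-elim (L4 _ _)

  contraposition : φ ⇒ ψ ⊑ ~ ψ ⇒ ~ φ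
  contraposition = ⇒-monoʳ ~~-intro ⨾ ⇒-monoˡ ~~-elim ⨾ L4 _ _

  ~-mono : φ ⊑ ψ → ~ ψ ⊑ ~ φ
  ~-mono p = mp p contraposition

  ⊥-sym : φ ⊥ ψ → ψ ⊥ φ
  ⊥-sym p = ~~-intro ⨾ ~-mono p

  ex-falso : ~ φ ⊑ φ ⇒ ψ
  ex-falso = L1 _ _ ⨾ L4 _ _

  ⊢~ : φ ⊑ ψ → ⊢ ~ ψ → ⊢ ~ φ
  ⊢~ p q = mp q (~-mono p)

  ⊢~falsum : ⊢ ~ falsum
  ⊢~falsum = mp ⊑-refl ~~-intro

  ~-⊑ : ⊢ ~ φ → φ ⊑ ψ
  ~-⊑ p = mp p ex-falso

  falsum-⊑ : falsum ⊑ φ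
  falsum-⊑ = ~-⊑ ⊢~falsum

  ≈-refl : φ ≈ φ
  ≈-refl = ⊑-refl , ⊑-refl

  ≈-sym : φ ≈ ψ → ψ ≈ φ
  ≈-sym (p , q) = q , p

  ≈-trans : φ ≈ ψ → ψ ≈ χ → φ ≈ χ
  ≈-trans (p , q) (p′ , q′) = (p ⨾ p′) , (q′ ⨾ q)

  ≈-setoid : Setoid _ _
  ≈-setoid = record
    { Carrier = Form Op
    ; _≈_ = _≈_
    ; isEquivalence = record { refl = ≈-refl ; sym = ≈-sym ; trans = ≈-trans }
    }

  module ≈-Reasoning = SetoidReasoning ≈-setoid

  ~-cong : φ ≈ ψ → ~ φ ≈ ~ ψ
  ~-cong (p , q) = ~-mono q , ~-mono p

  ⇒-cong : φ ≈ φ′ → ψ ≈ ψ′ → φ ⇒ ψ ≈ φ′ ⇒ ψ′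
  ⇒-cong (p , q) (r , s) = (⇒-monoˡ q ⨾ ⇒-monoʳ r) , (⇒-monoˡ p ⨾ ⇒-monoʳ s)

  ~~-≈ : ~ ~ φ ≈ φ
  ~~-≈ = ~~-elim , ~~-intro

  contraposition-≈ : ~ φ ⇒ ~ ψ ≈ ψ ⇒ φ
  contraposition-≈ = L4 _ _ , contraposition

  false-≈ : ⊢ ~ φ → ⊢ ~ ψ → φ ≈ ψ
  false-≈ p q = ~-⊑ p , ~-⊑ q

  ∨-monoˡ : φ ⊑ ψ → φ ∨ χ ⊑ ψ ∨ χ
  ∨-monoˡ p = ⇒-monoˡ (⇒-monoˡ p)

  ∨-absorb : φ ⊑ ψ → φ ∨ ψ ≈ ψ
  ∨-absorb p = mp p assertion , L1 _ _

  ∨-lub : φ ⊑ χ → ψ ⊑ χ → φ ∨ ψ ⊑ χ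
  ∨-lub p q = ∨-monoˡ p ⨾ L3 _ _ ⨾ to (∨-absorb q)

  ⊕-comm : φ ⊕ ψ ≈ ψ ⊕ φ
  ⊕-comm = lemma , lemma
    where
    lemma : φ ⊕ ψ ⊑ ψ ⊕ φ
    lemma = contraposition ⨾ ⇒-monoʳ ~~-elim

  ⊕-mono : φ ⊑ φ′ → ψ ⊑ ψ′ → φ ⊕ ψ ⊑ φ′ ⊕ ψ′
  ⊕-mono p q = ⇒-monoˡ (~-mono p) ⨾ ⇒-monoʳ q

  ⊕-cong : φ ≈ φ′ → ψ ≈ ψ′ → φ ⊕ ψ ≈ φ′ ⊕ ψ′
  ⊕-cong p q = ⇒-cong (~-cong p) q

  ⊕-assoc : (φ ⊕ ψ) ⊕ χ ≈ φ ⊕ (ψ ⊕ χ)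
  ⊕-assoc {φ} {ψ} {χ} = begin
    (φ ⊕ ψ) ⊕ χ     ≈⟨ ⊕-comm ⟩
    ~ χ ⇒ ~ φ ⇒ ψ   ≈⟨ ⇒-swap , ⇒-swap ⟩
    ~ φ ⇒ ~ χ ⇒ ψ   ≈⟨ ⇒-cong ≈-refl ⊕-comm ⟩
    φ ⊕ (ψ ⊕ χ)     ∎
    where open ≈-Reasoning

  ⊕-left-comm : φ ⊕ (ψ ⊕ χ) ≈ ψ ⊕ (φ ⊕ χ)
  ⊕-left-comm = ⇒-swap , ⇒-swap

  ⊑-⊕ˡ : φ ⊑ φ ⊕ ψ
  ⊑-⊕ˡ = ~~-intro ⨾ ex-falso

  ⊑-⊕ʳ : ψ ⊑ φ ⊕ ψ
  ⊑-⊕ʳ = L1 _ _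

  ⊕-identityˡ : ⊢ ~ φ → φ ⊕ ψ ≈ ψ
  ⊕-identityˡ p = (mp p assertion) , L1 _ _

  ⊕-identityʳ : ⊢ ~ ψ → φ ⊕ ψ ≈ φ
  ⊕-identityʳ p = ≈-trans ⊕-comm (⊕-identityˡ p)

  ∨-as-⊕ : ~ (φ ⇒ ψ) ⊕ ψ ≈ φ ∨ ψ
  ∨-as-⊕ = ⇒-cong ~~-≈ ≈-refl

  ⊖-⊑ : ~ (φ ⇒ ψ) ⊑ φ
  ⊖-⊑ = ~-mono ex-falso ⨾ ~~-elim

  ⊖-⊥ : ~ (φ ⇒ ψ) ⊥ ψ
  ⊖-⊥ = ~-mono (L1 _ _)

  ⊖-mono : φ ⊑ φ′ → ~ (φ ⇒ ψ) ⊑ ~ (φ′ ⇒ ψ)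
  ⊖-mono p = ~-mono (⇒-monoˡ p)

  -- The formula `(φ ⊕ ψ) ⇒ ψ` is literally `~ φ ∨ ψ`, which collapses to `~ φ` because `ψ ⊑ ~ φ`.
  ⊖-cancel : φ ⊥ ψ → ~ ((φ ⊕ ψ) ⇒ ψ) ≈ φ
  ⊖-cancel p = ≈-trans (~-cong (∨-lub ⊑-refl (⊥-sym p) , assertion)) ~~-≈

  -- By `⊖-cancel`, `χ` is `(χ ⊕ ψ) ⊖ ψ`, hence lies below `~ φ ⊖ ψ`, which is literally
  -- `~ (φ ⊕ ψ)`.
  ⊕-⊥-assoc : ψ ⊥ χ → φ ⊥ ψ ⊕ χ → φ ⊕ ψ ⊥ χ
  ⊕-⊥-assoc p q = ⊥-sym
    (from (⊖-cancel (⊥-sym p)) ⨾ ⊖-mono (to ⊕-comm ⨾ ⊥-sym q))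

  ⊕-⊥-assoc′ : φ ⊥ ψ → φ ⊕ ψ ⊥ χ → φ ⊥ ψ ⊕ χ
  ⊕-⊥-assoc′ p q = ⊥-sym
    (to ⊕-comm ⨾ ⊕-⊥-assoc (⊥-sym p) (⊥-sym q ⨾ ~-mono (to ⊕-comm)))

  -- Regroups a four-term sum that stays within 1; this is the induction step of `•-⊥`.
  ⊕-⊥-interchange : φ ⊥ ψ → φ′ ⊥ ψ′ → φ ⊕ ψ ⊥ φ′ ⊕ ψ′ → φ ⊕ φ′ ⊥ ψ ⊕ ψ′
  ⊕-⊥-interchange {φ} {ψ} {φ′} {ψ′} p q r =
    ⊕-⊥-assoc φ′⊥ψ⊕ψ′ (⊕-⊥-assoc′ p r ⨾ ~-mono (to ⊕-left-comm))
    where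
    ψ⊥φ′⊕ψ′ : ψ ⊥ φ′ ⊕ ψ′
    ψ⊥φ′⊕ψ′ = ⊑-⊕ʳ ⨾ r

    φ′⊥ψ⊕ψ′ : φ′ ⊥ ψ ⊕ ψ′
    φ′⊥ψ⊕ψ′ = ⊕-⊥-assoc′ (⊑-⊕ˡ ⨾ ⊥-sym ψ⊥φ′⊕ψ′)
      (to ⊕-comm ⨾ ⊕-⊥-assoc q ψ⊥φ′⊕ψ′)

  -- With γ = φ ∨ ψ, the hypotheses make χ orthogonal to γ although χ ⊕ γ ⊑ γ.
  ⊖-disjoint : χ ⊑ ~ (φ ⇒ ψ) → χ ⊑ ~ (ψ ⇒ φ) → ⊢ ~ χ
  ⊖-disjoint {χ} {φ} {ψ} p q = ⊢~ (from (⊖-cancel χ⊥γ)) (mp χ⊕γ⊑γ ~~-intro)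
    where
    γ = φ ∨ ψ

    χ⊥φ : χ ⊥ φ
    χ⊥φ = q ⨾ ⊖-⊥

    χ⊥ψ : χ ⊥ ψ
    χ⊥ψ = p ⨾ ⊖-⊥

    χ⊥γ : χ ⊥ γ
    χ⊥γ = ⊥-sym (∨-lub (⊥-sym χ⊥φ) (⊥-sym χ⊥ψ))

    χ⊑γ : χ ⊑ γ
    χ⊑γ = p ⨾ ⊖-⊑ ⨾ assertion

    below : θ ⊥ χ → θ ⊕ χ ⊑ γ → θ ⊑ ~ (γ ⇒ χ)
    below θ⊥χ θ⊕χ⊑γ = from (⊖-cancel θ⊥χ) ⨾ ⊖-mono θ⊕χ⊑γ

    γ⊑γ⊖χ : γ ⊑ ~ (γ ⇒ χ)
    γ⊑γ⊖χ = ∨-lub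
      (below (⊥-sym χ⊥φ) (to ⊕-comm ⨾ ⊕-mono q ⊑-refl ⨾ to ∨-as-⊕ ⨾ L3 _ _))
      (below (⊥-sym χ⊥ψ) (to ⊕-comm ⨾ ⊕-mono p ⊑-refl ⨾ to ∨-as-⊕))

    χ⊕γ⊑γ : χ ⊕ γ ⊑ γ
    χ⊕γ⊑γ = to ⊕-comm ⨾ ⇒-monoˡ (⊥-sym γ⊑γ⊖χ) ⨾ ∨-lub ⊑-refl χ⊑γ

  -- The negated disjunction lies below both `φ ⊖ ψ` and `ψ ⊖ φ`, so `⊖-disjoint` refutes it.
  prelinearity : ∀ φ ψ → ⊢ (φ ⇒ ψ) ∨ (ψ ⇒ φ)
  prelinearity φ ψ = mp (⊖-disjoint (~-mono assertion) (~-mono (L1 _ _))) ~~-elim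

  -- Multiples and sums without truncation

  -- Absorbs the special clause for one-fold sums, so that later inductions have a uniform successor
  -- case.
  •-suc : ∀ k → suc k • φ ≈ φ ⊕ (k • φ)
  •-suc zero    = ≈-sym (⊕-identityʳ ⊢~falsum)
  •-suc (suc k) = ≈-refl

  •-mono : ∀ k → φ ⊑ ψ → k • φ ⊑ k • ψ
  •-mono 0             p = ⊑-refl
  •-mono 1             p = p
  •-mono (suc (suc k)) p = ⊕-mono p (•-mono (suc k) p)

  •-cong : ∀ k → φ ≈ ψ → k • φ ≈ k • ψ
  •-cong k (p , q) = •-mono k p , •-mono k q

  •-+ : ∀ a b → (a + b) • φ ≈ (a • φ) ⊕ (b • φ)
  •-+ zero    b = ≈-sym (⊕-identityˡ ⊢~falsum)
  •-+ {φ} (suc a) b = begin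
    suc (a + b) • φ               ≈⟨ •-suc (a + b) ⟩
    φ ⊕ ((a + b) • φ)             ≈⟨ ⊕-cong ≈-refl (•-+ a b) ⟩
    φ ⊕ ((a • φ) ⊕ (b • φ))       ≈⟨ ⊕-assoc ⟨
    (φ ⊕ (a • φ)) ⊕ (b • φ)       ≈⟨ ⊕-cong (•-suc a) ≈-refl ⟨
    (suc a • φ) ⊕ (b • φ)         ∎
    where open ≈-Reasoning

  •-* : ∀ a b → (a * b) • φ ≈ a • (b • φ)
  •-* zero    b = ≈-refl
  •-* {φ} (suc a) b = begin
    (b + a * b) • φ           ≈⟨ •-+ b (a * b) ⟩
    (b • φ) ⊕ ((a * b) • φ)   ≈⟨ ⊕-cong ≈-refl (•-* a b) ⟩
    (b • φ) ⊕ (a • (b • φ))   ≈⟨ •-suc a ⟨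
    suc a • (b • φ)           ∎
    where open ≈-Reasoning

  •-falsum : ∀ k → ⊢ ~ φ → ⊢ ~ (k • φ)
  •-falsum 0             p = ⊢~falsum
  •-falsum 1             p = p
  •-falsum (suc (suc k)) p = ⊢~ (to (⊕-identityˡ p)) (•-falsum (suc k) p)

  •-monoˡ : ∀ {a b} → a ≤ b → a • φ ⊑ b • φ
  •-monoˡ {b = b} z≤n = falsum-⊑
  •-monoˡ {a = suc a} {suc b} (s≤s p) =
    to (•-suc a) ⨾ ⊕-mono ⊑-refl (•-monoˡ p) ⨾ from (•-suc b)

  -- The n-fold sum of φ is not truncated at 1.
  Summable : ℕ → Form Op → Set
  Summable n φ = ∀ a b → a + b ≤ n → a • φ ⊥ b • φ

  -- Induction on `a` carries one copy of `φ` at a time across `⊥` by `⊕-⊥-assoc`; the hypothesis,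
  -- weakened from `n ∸ 1` to `b` copies, makes that copy orthogonal to the right-hand sum.
  summable : ∀ n → φ ⊥ (n ∸ 1) • φ → Summable n φ
  summable n p zero    b q = falsum-⊑
  summable (suc n) p (suc a) b (s≤s q) = to (≈-trans (•-suc a) ⊕-comm) ⨾
    ⊕-⊥-assoc (p ⨾ ~-mono (•-monoˡ (ℕₚ.≤-trans (ℕₚ.m≤n+m b a) q)))
      (summable (suc n) p a (suc b) (ℕₚ.≤-trans (ℕₚ.≤-reflexive (ℕₚ.+-suc a b)) (s≤s q))
        ⨾ ~-mono (from (•-suc b)))

  Summable-mono : ∀ {n} → φ ⊑ ψ → Summable n ψ → Summable n φ
  Summable-mono p s a b q = •-mono a p ⨾ s a b q ⨾ ~-mono (•-mono b p)

  Summable-≤ : ∀ {m n} → m ≤ n → Summable n φ → Summable m φ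
  Summable-≤ m≤n s a b q = s a b (ℕₚ.≤-trans q m≤n)

  Summable-• : ∀ m n → Summable (n * m) φ → Summable n (m • φ)
  Summable-• m n s a b q = from (•-* a m) ⨾
    s (a * m) (b * m) (subst (_≤ n * m) (ℕₚ.*-distribʳ-+ m a b) (ℕₚ.*-monoˡ-≤ m q)) ⨾
    ~-mono (from (•-* b m))

  -- For `b ≤ a` the multiple splits into `a ∸ b` and `b` copies, and summability lets `⊖-cancel`
  -- remove the latter; for `a ≤ b` both sides are refutable.
  ∸-• : ∀ a b {n} → a ≤ n → Summable n φ → (a ∸ b) • φ ≈ ~ (a • φ ⇒ b • φ)
  ∸-• {φ} a b {n} a≤n s with ℕₚ.≤-total a b
  ... | inj₁ a≤b = subst (λ k → k • φ ≈ ~ (a • φ ⇒ b • φ)) (sym (ℕₚ.m≤n⇒m∸n≡0 a≤b))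
    (false-≈ ⊢~falsum (mp (•-monoˡ a≤b) ~~-intro))
  ... | inj₂ b≤a = begin
    (a ∸ b) • φ                              ≈⟨ ⊖-cancel (s (a ∸ b) b (subst (_≤ n) (sym eq) a≤n)) ⟨
    ~ (((a ∸ b) • φ) ⊕ (b • φ) ⇒ b • φ)      ≈⟨ ~-cong (⇒-cong (•-+ (a ∸ b) b) ≈-refl) ⟨
    ~ ((a ∸ b + b) • φ ⇒ b • φ)              ≡⟨ cong (λ k → ~ (k • φ ⇒ b • φ)) eq ⟩
    ~ (a • φ ⇒ b • φ)                        ∎
    where
    open ≈-Reasoning
    eq : a ∸ b + b ≡ a
    eq = ℕₚ.m∸n+n≡m b≤a

  •-⊕ : ∀ k → k • (φ ⊕ ψ) ≈ (k • φ) ⊕ (k • ψ)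
  •-⊕ zero = ≈-sym (⊕-identityˡ ⊢~falsum)
  •-⊕ {φ} {ψ} (suc k) = begin
    suc k • (φ ⊕ ψ)                       ≈⟨ •-suc k ⟩
    (φ ⊕ ψ) ⊕ (k • (φ ⊕ ψ))               ≈⟨ ⊕-cong ≈-refl (•-⊕ k) ⟩
    (φ ⊕ ψ) ⊕ ((k • φ) ⊕ (k • ψ))         ≈⟨ ⊕-assoc ⟩
    φ ⊕ (ψ ⊕ ((k • φ) ⊕ (k • ψ)))         ≈⟨ ⊕-cong ≈-refl ⊕-left-comm ⟩
    φ ⊕ ((k • φ) ⊕ (ψ ⊕ (k • ψ)))         ≈⟨ ⊕-assoc ⟨
    (φ ⊕ (k • φ)) ⊕ (ψ ⊕ (k • ψ))         ≈⟨ ⊕-cong (•-suc k) (•-suc k) ⟨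
    (suc k • φ) ⊕ (suc k • ψ)             ∎
    where open ≈-Reasoning

  -- The instance `s 1 k` says that `φ ⊕ ψ` fits beside `k` further copies of itself, which is the
  -- third premise of `⊕-⊥-interchange`.
  •-⊥ : ∀ k → φ ⊥ ψ → Summable k (φ ⊕ ψ) → k • φ ⊥ k • ψ
  •-⊥ zero    p s = falsum-⊑
  •-⊥ (suc k) p s = to (•-suc k) ⨾
    ⊕-⊥-interchange p (•-⊥ k p (Summable-≤ (ℕₚ.n≤1+n k) s))
      (s 1 k ℕₚ.≤-refl ⨾ ~-mono (from (•-⊕ k))) ⨾
    ~-mono (to (•-suc k))

  -- Here `φ` is `ρ ⊕ ψ`, so `n • φ` distributes and `⊖-cancel` removes `n • ψ`.
  •-⊖-of-⊒ : ∀ n → ψ ⊑ φ → Summable n φ → n • ~ (φ ⇒ ψ) ≈ ~ (n • φ ⇒ n • ψ)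
  •-⊖-of-⊒ {ψ} {φ} n p s = begin
    n • ρ                          ≈⟨ ⊖-cancel (•-⊥ n ⊖-⊥ (Summable-mono (to ρ⊕ψ≈φ) s)) ⟨
    ~ ((n • ρ) ⊕ (n • ψ) ⇒ n • ψ)  ≈⟨ ~-cong (⇒-cong (•-⊕ n) ≈-refl) ⟨
    ~ (n • (ρ ⊕ ψ) ⇒ n • ψ)        ≈⟨ ~-cong (⇒-cong (•-cong n ρ⊕ψ≈φ) ≈-refl) ⟩
    ~ (n • φ ⇒ n • ψ)              ∎
    where
    open ≈-Reasoning
    ρ = ~ (φ ⇒ ψ)
    ρ⊕ψ≈φ : ρ ⊕ ψ ≈ φ
    ρ⊕ψ≈φ = ≈-trans ∨-as-⊕ (∨-lub ⊑-refl p , assertion)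

  •-⊖-of-⊑ : ∀ n → φ ⊑ ψ → n • ~ (φ ⇒ ψ) ≈ ~ (n • φ ⇒ n • ψ)
  •-⊖-of-⊑ n p = false-≈ (•-falsum n (mp p ~~-intro)) (mp (•-mono n p) ~~-intro)

-- Reasoning by cases on the order of two formulas

infixl 4 _,,_

-- Only the single formula `α` is added, not a schema, so it acts as a hypothesis.
data _,,_ {Op : Set} (Ax : Form Op → Set) (α : Form Op) : Form Op → Set where
  old : ∀ {φ} → Ax φ → (Ax ,, α) φ
  new : (Ax ,, α) α

module _ {Op : Set} {Ax : Form Op → Set} where

  open Łukasiewicz Ax

  weaken : ∀ {α φ} → ⊢ φ → Theorem (Ax ,, α) φ
  weaken (L1 φ ψ)   = L1 φ ψ
  weaken (L2 φ ψ χ) = L2 φ ψ χ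
  weaken (L3 φ ψ)   = L3 φ ψ
  weaken (L4 φ ψ)   = L4 φ ψ
  weaken (ax p)     = ax (old p)
  weaken (mp p q)   = mp (weaken p) (weaken q)

  private
    -- The derivation is repeated with `β` as a second disjunct on every line; where it cites `α`,
    -- the given disjunction takes over.
    case : ∀ {α β φ} → ⊢ α ∨ β → Theorem (Ax ,, α) φ → ⊢ φ ∨ β
    case p (L1 φ ψ)     = mp (L1 φ ψ) assertion
    case p (L2 φ ψ χ)   = mp (L2 φ ψ χ) assertion
    case p (L3 φ ψ)     = mp (L3 φ ψ) assertion
    case p (L4 φ ψ)     = mp (L4 φ ψ) assertion
    case p (ax (old q)) = mp (ax q) assertion
    case p (ax new)     = p
    -- For a step from `χ` and `χ ⇒ φ`, both disjuncts of `(χ ⇒ φ) ∨ β` imply `χ ∨ β ⇒ φ ∨ β`: the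
    -- first by monotonicity, the second because `β ⊑ φ ∨ β`.
    case p (mp q r)     = mp (case p q)
      (mp (case p r) (∨-lub (L2 _ _ _ ⨾ L2 _ _ _) (L1 _ _ ⨾ L1 _ _)))

  by-cases : ∀ {φ} α β → Theorem (Ax ,, α ⇒ β) φ → Theorem (Ax ,, β ⇒ α) φ → ⊢ φ
  by-cases α β p q =
    -- The first case yields `φ ∨ (β ⇒ α)`; commuted, it is the disjunction for the second case,
    -- which leaves `φ ∨ φ`.
    mp (case (mp (case (prelinearity α β) p) (L3 _ _)) q) (∨-lub ⊑-refl ⊑-refl)

  •-⊖ : ∀ {φ ψ} n → Summable n φ → n • ~ (φ ⇒ ψ) ≈ ~ (n • φ ⇒ n • ψ)
  •-⊖ {φ} {ψ} n s = by-cases φ ψ (φ⊑ψ.to below) (ψ⊑φ.to above) ,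
                    by-cases φ ψ (φ⊑ψ.from below) (ψ⊑φ.from above)
    where
    module φ⊑ψ = Łukasiewicz (Ax ,, φ ⇒ ψ)
    module ψ⊑φ = Łukasiewicz (Ax ,, ψ ⇒ φ)
    below = φ⊑ψ.•-⊖-of-⊑ n (ax new)
    above = ψ⊑φ.•-⊖-of-⊒ n (ax new) (λ a b q → weaken (s a b q))

  -- As the multiplier is at least 1, `φ ⊖ ψ` lies below its own multiple, which `•-⊖` identifies
  -- with the refutable `n • φ ⊖ n • ψ`.
  •-cancel-⊑ : ∀ {φ ψ} n .{{_ : NonZero n}} → Summable n φ → n • φ ⊑ n • ψ → φ ⊑ ψ
  •-cancel-⊑ {φ} {ψ} (suc n) s p =
    mp (⊢~ (•-monoˡ (s≤s z≤n) ⨾ to (•-⊖ (suc n) s)) (mp p ~~-intro)) ~~-elim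

  •-cancel : ∀ {φ ψ} n .{{_ : NonZero n}} →
    Summable n φ → Summable n ψ → n • φ ≈ n • ψ → φ ≈ ψ
  •-cancel n s t (p , q) = •-cancel-⊑ n s p , •-cancel-⊑ n t q

-- Arithmetic of fractions in the unit interval

module Fractions where

  open ≡-Reasoning

  [0,1]-≡ : ∀ {r q} → value r ≡ value q → r ≡ q
  [0,1]-≡ refl = refl

  -- The bound is stored irrelevantly; decidability of the order recovers a usable proof.
  0≤value : ∀ r → 0ℚ ℚ.≤ value r
  0≤value (unit r 0≤r _) = recompute (0ℚ ℚₚ.≤? r) 0≤r

  value≤1 : ∀ r → value r ℚ.≤ 1ℚ
  value≤1 (unit r _ r≤1) = recompute (r ℚₚ.≤? 1ℚ) r≤1

  +-monus : ∀ s q → 0ℚ ℚ.≤ s → 0ℚ ⊔ (s ℚ.+ q ℚ.- q) ≡ s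
  +-monus s q 0≤s = begin
    0ℚ ⊔ (s ℚ.+ q ℚ.- q)    ≡⟨ cong (0ℚ ⊔_) (ℚₚ.+-assoc s q (ℚ.- q)) ⟩
    0ℚ ⊔ (s ℚ.+ (q ℚ.- q))  ≡⟨ cong (λ x → 0ℚ ⊔ (s ℚ.+ x)) (ℚₚ.+-inverseʳ q) ⟩
    0ℚ ⊔ (s ℚ.+ 0ℚ)         ≡⟨ cong (0ℚ ⊔_) (ℚₚ.+-identityʳ s) ⟩
    0ℚ ⊔ s                  ≡⟨ ℚₚ.p≤q⇒p⊔q≡q 0≤s ⟩
    s                       ∎

  ⊙-+ : ∀ r q t → value t ≡ value r ℚ.+ value q → t ⊙ q * ≡ r
  ⊙-+ r q t eq = [0,1]-≡ (trans (cong (λ x → 0ℚ ⊔ (x ℚ.- value q)) eq)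
    (+-monus (value r) (value q) (0≤value r)))

  ⊙-≤ : ∀ r q → value r ℚ.≤ value q → value (r ⊙ q *) ≡ 0ℚ
  ⊙-≤ r q r≤q = ℚₚ.p≥q⇒p⊔q≡p
    (subst (value r ℚ.- value q ℚ.≤_) (ℚₚ.+-inverseʳ (value q)) (ℚₚ.+-monoˡ-≤ (ℚ.- value q) r≤q))

  p≤p+q : ∀ p {q} → 0ℚ ℚ.≤ q → p ℚ.≤ p ℚ.+ q
  p≤p+q p {q} 0≤q = subst (ℚ._≤ p ℚ.+ q) (ℚₚ.+-identityʳ p) (ℚₚ.+-monoʳ-≤ p 0≤q)

  fromℚᵘ-homo-+ : ∀ p q → ℚ.fromℚᵘ (p ℚᵘ.+ q) ≡ ℚ.fromℚᵘ p ℚ.+ ℚ.fromℚᵘ q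
  fromℚᵘ-homo-+ p q = ℚₚ.toℚᵘ-injective (ℚᵘₚ.≃-trans (ℚₚ.toℚᵘ-fromℚᵘ (p ℚᵘ.+ q))
    (ℚᵘₚ.≃-sym (ℚᵘₚ.≃-trans (ℚₚ.toℚᵘ-homo-+ (ℚ.fromℚᵘ p) (ℚ.fromℚᵘ q))
      (ℚᵘₚ.+-cong (ℚₚ.toℚᵘ-fromℚᵘ p) (ℚₚ.toℚᵘ-fromℚᵘ q)))))

  fromℚᵘ-homo-* : ∀ p q → ℚ.fromℚᵘ (p ℚᵘ.* q) ≡ ℚ.fromℚᵘ p ℚ.* ℚ.fromℚᵘ q
  fromℚᵘ-homo-* p q = ℚₚ.toℚᵘ-injective (ℚᵘₚ.≃-trans (ℚₚ.toℚᵘ-fromℚᵘ (p ℚᵘ.* q))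
    (ℚᵘₚ.≃-sym (ℚᵘₚ.≃-trans (ℚₚ.toℚᵘ-homo-* (ℚ.fromℚᵘ p) (ℚ.fromℚᵘ q))
      (ℚᵘₚ.*-cong (ℚₚ.toℚᵘ-fromℚᵘ p) (ℚₚ.toℚᵘ-fromℚᵘ q)))))

  /-cross : ∀ a b n N .{{_ : NonZero n}} .{{_ : NonZero N}} →
    + a / n ≡ + b / N → a * N ≡ b * n
  /-cross a b (suc n) (suc N) eq with ℚₚ./-injective-≃ (mkℚᵘ (+ a) n) (mkℚᵘ (+ b) N) eq
  ... | *≡* e = ℤₚ.+-injective (trans (ℤₚ.pos-* a (suc N)) (trans e (sym (ℤₚ.pos-* b (suc n)))))

  cross-/ : ∀ a b n N .{{_ : NonZero n}} .{{_ : NonZero N}} →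
    a * N ≡ b * n → + a / n ≡ + b / N
  cross-/ a b (suc n) (suc N) eq = ℚₚ.fromℚᵘ-cong {mkℚᵘ (+ a) n} {mkℚᵘ (+ b) N}
    (*≡* (trans (sym (ℤₚ.pos-* a (suc N))) (trans (cong +_ eq) (ℤₚ.pos-* b (suc n)))))

  /-* : ∀ a b n N .{{_ : NonZero n}} .{{_ : NonZero N}} .{{_ : NonZero (n * N)}} →
    + (a * b) / (n * N) ≡ (+ a / n) ℚ.* (+ b / N)
  /-* a b (suc n) (suc N) = trans (cong (_/ (suc n * suc N)) (ℤₚ.pos-* a b))
    (fromℚᵘ-homo-* (mkℚᵘ (+ a) n) (mkℚᵘ (+ b) N))

  /-+ : ∀ a b n .{{_ : NonZero n}} → + (a + b) / n ≡ (+ a / n) ℚ.+ (+ b / n)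
  /-+ a b (suc n) = trans
    (ℚₚ.fromℚᵘ-cong {mkℚᵘ (+ (a + b)) n} {mkℚᵘ (+ a) n ℚᵘ.+ mkℚᵘ (+ b) n} (*≡* (begin
      + (a + b) ℤ.* (N ℤ.* N)              ≡⟨ ℤₚ.*-assoc (+ (a + b)) N N ⟨
      + (a + b) ℤ.* N ℤ.* N                ≡⟨ cong (ℤ._* N) (ℤₚ.*-distribʳ-+ N (+ a) (+ b)) ⟩
      (+ a ℤ.* N ℤ.+ + b ℤ.* N) ℤ.* N      ∎)))
    (fromℚᵘ-homo-+ (mkℚᵘ (+ a) n) (mkℚᵘ (+ b) n))
    where N = + suc n

  0≤/ : ∀ a n .{{_ : NonZero n}} → 0ℚ ℚ.≤ + a / n
  0≤/ a n = ℚₚ.nonNegative⁻¹ (+ a / n) {{ℚₚ.normalize-nonNeg a n}}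

  /-mono : ∀ {a b} n .{{_ : NonZero n}} → a ≤ b → + a / n ℚ.≤ + b / n
  /-mono {a} {b} n a≤b = subst (+ a / n ℚ.≤_)
    (trans (sym (/-+ a (b ∸ a) n)) (cong (λ k → + k / n) (ℕₚ.m+[n∸m]≡n a≤b)))
    (p≤p+q (+ a / n) (0≤/ (b ∸ a) n))

  ⊙-/ : ∀ r q a b n .{{_ : NonZero n}} →
    value r ≡ + a / n → value q ≡ + b / n → value (r ⊙ q *) ≡ + (a ∸ b) / n
  ⊙-/ r q a b n r≡ q≡ with ℕₚ.≤-total a b
  ... | inj₁ a≤b = begin
    value (r ⊙ q *)    ≡⟨ ⊙-≤ r q (subst₂ ℚ._≤_ (sym r≡) (sym q≡) (/-mono n a≤b)) ⟩
    0ℚ                 ≡⟨ ℚₚ.0/n≡0 n ⟨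
    + 0 / n            ≡⟨ cong (λ k → + k / n) (ℕₚ.m≤n⇒m∸n≡0 a≤b) ⟨
    + (a ∸ b) / n      ∎
  ... | inj₂ b≤a = begin
    0ℚ ⊔ (value r ℚ.- value q)                    ≡⟨ cong₂ (λ x y → 0ℚ ⊔ (x ℚ.- y)) r≡ q≡ ⟩
    0ℚ ⊔ (+ a / n ℚ.- + b / n)                    ≡⟨ cong (λ k → 0ℚ ⊔ (+ k / n ℚ.- + b / n)) (ℕₚ.m∸n+n≡m b≤a) ⟨
    0ℚ ⊔ (+ (a ∸ b + b) / n ℚ.- + b / n)          ≡⟨ cong (λ x → 0ℚ ⊔ (x ℚ.- + b / n)) (/-+ (a ∸ b) b n) ⟩
    0ℚ ⊔ (+ (a ∸ b) / n ℚ.+ + b / n ℚ.- + b / n)  ≡⟨ +-monus (+ (a ∸ b) / n) (+ b / n) (0≤/ (a ∸ b) n) ⟩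
    + (a ∸ b) / n                                 ∎

  n/n≡1 : ∀ n .{{_ : NonZero n}} → + n / n ≡ 1ℚ
  n/n≡1 n = cross-/ n 1 n 1 (ℕₚ.*-comm n 1)

open Fractions

-- Derived laws of `∇` and `Δ`, and soundness of `I₁`

module 𝒬Ł where

  open Łukasiewicz Axiom𝒬 public

  private variable
    φ ψ : Form𝒬

  -- Q2 with both indices `r` derives `∇ (r ⊙ r *) φ` from an identity, and `r ⊙ r *` is `r` when
  -- `r` is zero.
  ∇-zero : ∀ {r} → value r ≡ 0ℚ → ⊢ ∇ r φ
  ∇-zero {φ} {r} r≡0 = subst (λ t → ⊢ ∇ t φ) (⊙-+ r r r r≡r+r) (mp ⊑-refl (ax (Q2← r r φ)))
    where
    r≡r+r : value r ≡ value r ℚ.+ value r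
    r≡r+r = sym (trans (cong (ℚ._+ value r) r≡0) (ℚₚ.+-identityˡ (value r)))

  -- Necessitation: `r ⊙ 1ᵘ *` is zero, so Q2 yields `∇ 1ᵘ φ ⇒ ∇ r φ`, and Q4 supplies the premise.
  ∇-nec : ∀ r → ⊢ φ → ⊢ ∇ r φ
  ∇-nec {φ} r p = mp (mp p (ax (Q4← φ)))
    (mp (∇-zero (⊙-≤ r 1ᵘ (value≤1 r))) (ax (Q2→ r 1ᵘ φ)))

  ∇-mono : ∀ r → φ ⊑ ψ → ∇ r φ ⊑ ∇ r ψ
  ∇-mono r p = mp (∇-nec r p) (ax (Q1→ r _ _))

  ∇-cong : ∀ r → φ ≈ ψ → ∇ r φ ≈ ∇ r ψ
  ∇-cong r (p , q) = ∇-mono r p , ∇-mono r q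

  Δ-cong : ∀ r → φ ≈ ψ → Δ r φ ≈ Δ r ψ
  Δ-cong r p = ~-cong (∇-cong r (~-cong p))

  Δ-zero : ∀ {r} → value r ≡ 0ℚ → ⊢ ~ Δ r φ
  Δ-zero r≡0 = mp (∇-zero r≡0) ~~-intro

  Δ-one : Δ 1ᵘ φ ≈ φ
  Δ-one = ≈-trans (~-cong (ax (Q4→ _) , ax (Q4← _))) ~~-≈

  Δ-⊙ : ∀ r q → Δ (r ⊙ q *) φ ≈ ~ (Δ r φ ⇒ Δ q φ)
  Δ-⊙ r q = ~-cong (≈-trans (ax (Q2→ r q _) , ax (Q2← r q _)) (≈-sym contraposition-≈))

  -- Q2 speaks of subtraction only. Since `Δ q φ ⊑ Δ t φ`, the formula `Δ t φ` is recovered by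
  -- adding `Δ q φ` back to the difference `Δ (t ⊙ q *) φ`.
  Δ-+ : ∀ r q t → value t ≡ value r ℚ.+ value q → Δ t φ ≈ Δ r φ ⊕ Δ q φ
  Δ-+ {φ} r q t eq = begin
    Δ t φ                            ≈⟨ ∨-lub ⊑-refl Δq⊑Δt , assertion ⟨
    Δ t φ ∨ Δ q φ                    ≈⟨ ∨-as-⊕ ⟨
    ~ (Δ t φ ⇒ Δ q φ) ⊕ Δ q φ        ≈⟨ ⊕-cong (Δ-⊙ t q) ≈-refl ⟨
    Δ (t ⊙ q *) φ ⊕ Δ q φ            ≡⟨ cong (λ x → Δ x φ ⊕ Δ q φ) (⊙-+ r q t eq) ⟩
    Δ r φ ⊕ Δ q φ                    ∎
    where
    open ≈-Reasoning
    q≤t : value q ℚ.≤ value t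
    q≤t = subst (value q ℚ.≤_) (trans (ℚₚ.+-comm (value q) (value r)) (sym eq))
      (p≤p+q (value q) (0≤value r))
    Δq⊑Δt : Δ q φ ⊑ Δ t φ
    Δq⊑Δt = mp (⊢~ (from (Δ-⊙ q t)) (Δ-zero (⊙-≤ q t q≤t))) ~~-elim

  •-Δ : ∀ k n .{{_ : NonZero n}} r → value r ≡ + k / n → k • Δ (1/ₙ n) φ ≈ Δ r φ
  •-Δ zero n r eq = false-≈ ⊢~falsum (Δ-zero (trans eq (ℚₚ.0/n≡0 n)))
  •-Δ {φ} (suc k) n r eq = begin
    suc k • Δ (1/ₙ n) φ               ≈⟨ •-suc k ⟩
    Δ (1/ₙ n) φ ⊕ (k • Δ (1/ₙ n) φ)   ≈⟨ ⊕-cong ≈-refl (•-Δ k n s s≡k/n) ⟩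
    Δ (1/ₙ n) φ ⊕ Δ s φ               ≈⟨ Δ-+ (1/ₙ n) s r r≡ ⟨
    Δ r φ                             ∎
    where
    open ≈-Reasoning
    s = r ⊙ 1/ₙ n *
    s≡k/n : value s ≡ + k / n
    s≡k/n = ⊙-/ r (1/ₙ n) (suc k) 1 n eq refl
    r≡ : value r ≡ + 1 / n ℚ.+ value s
    r≡ = trans eq (trans (/-+ 1 k n) (cong (+ 1 / n ℚ.+_) (sym s≡k/n)))

  Δ-division : ∀ n .{{_ : NonZero n}} → n • Δ (1/ₙ n) φ ≈ φ
  Δ-division n = ≈-trans (•-Δ n n 1ᵘ (sym (n/n≡1 n))) Δ-one

  -- The right-hand multiple is `Δ` at `1 - 1/n`, that is `Δ 1ᵘ φ ⊖ Δ (1/ₙ n) φ`, and a difference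
  -- is orthogonal to what was subtracted.
  Δ-summable : ∀ n .{{_ : NonZero n}} → Δ (1/ₙ n) φ ⊥ (n ∸ 1) • Δ (1/ₙ n) φ
  Δ-summable {φ} n = ⊥-sym (to (•-Δ (n ∸ 1) n r r≡) ⨾ to (Δ-⊙ 1ᵘ (1/ₙ n)) ⨾ ⊖-⊥)
    where
    r = 1ᵘ ⊙ 1/ₙ n *
    r≡ : value r ≡ + (n ∸ 1) / n
    r≡ = ⊙-/ 1ᵘ (1/ₙ n) n 1 n (sym (n/n≡1 n)) refl

  unfoldΔ-unfold∇ : ∀ ψ → unfoldΔ (unfold∇ ψ) ≈ ψ
  unfoldΔ-unfold∇ (var i)          = ≈-refl
  unfoldΔ-unfold∇ (~ ψ)            = ~-cong (unfoldΔ-unfold∇ ψ)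
  unfoldΔ-unfold∇ (φ ⇒ ψ)          = ⇒-cong (unfoldΔ-unfold∇ φ) (unfoldΔ-unfold∇ ψ)
  unfoldΔ-unfold∇ (op (nabla r) ψ) =
    ≈-trans ~~-≈ (∇-cong r (≈-trans ~~-≈ (unfoldΔ-unfold∇ ψ)))

  unfoldΔ-I₁-• : ∀ k φ → unfoldΔ (I₁ (k • φ)) ≡ k • unfoldΔ (I₁ φ)
  unfoldΔ-I₁-• 0             φ = refl
  unfoldΔ-I₁-• 1             φ = refl
  unfoldΔ-I₁-• (suc (suc k)) φ = cong (unfoldΔ (I₁ φ) ⊕_) (unfoldΔ-I₁-• (suc k) φ)

  sound : ∀ {φ} → ⊢Rat φ → ⊢𝒬ᐞ I₁ φ
  sound (L1 φ ψ)          = L1 _ _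
  sound (L2 φ ψ χ)        = L2 _ _ _
  sound (L3 φ ψ)          = L3 _ _
  sound (L4 φ ψ)          = L4 _ _
  sound (mp p q)          = mp (sound p) (sound q)
  sound (ax (D1 n φ))     = subst (_⊑ unfoldΔ (I₁ φ)) (sym (unfoldΔ-I₁-• n (δ n φ)))
    (to (Δ-division n))
  sound (ax (D2 n φ))     = subst (unfoldΔ (I₁ φ) ⊑_) (sym (unfoldΔ-I₁-• n (δ n φ)))
    (from (Δ-division n))
  sound (ax (D3 n φ))     =
    subst (λ θ → ⊢ ~ Δ (1/ₙ n) (unfoldΔ (I₁ φ)) ⊕ ~ θ) (sym (unfoldΔ-I₁-• (n ∸ 1) (δ n φ)))
      -- Unfolding `⊕` shows D3 to be an orthogonality with a doubly negated left side.
      (~~-elim ⨾ Δ-summable n)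

-- The composite of `I₂` followed by `I₁`

module _ (rep : Representation) where

  open Representation rep

  I₁-I₂ : ∀ ψ → unfoldΔ (I₁ (I₂ rep ψ)) 𝒬Ł.≈ unfoldΔ ψ
  I₁-I₂ (var i)          = 𝒬Ł.≈-refl
  I₁-I₂ (~ ψ)            = 𝒬Ł.~-cong (I₁-I₂ ψ)
  I₁-I₂ (φ ⇒ ψ)          = 𝒬Ł.⇒-cong (I₁-I₂ φ) (I₁-I₂ ψ)
  I₁-I₂ (op (delta r) ψ) = begin
    unfoldΔ (I₁ (num r • δ (den r) (I₂ rep ψ)))        ≡⟨ unfoldΔ-I₁-• (num r) _ ⟩
    num r • Δ (1/ₙ den r) (unfoldΔ (I₁ (I₂ rep ψ)))    ≈⟨ •-Δ (num r) (den r) r (sym (represents r)) ⟩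
    Δ r (unfoldΔ (I₁ (I₂ rep ψ)))                      ≈⟨ Δ-cong r (I₁-I₂ ψ) ⟩
    Δ r (unfoldΔ ψ)                                    ∎
    where
    open 𝒬Ł
    open ≈-Reasoning

-- Division in Rational Łukasiewicz logic

module Rat where

  open Łukasiewicz AxiomRat public

  private variable
    φ ψ : FormRat

  •-δ : ∀ n .{{_ : NonZero n}} → n • δ n φ ≈ φ
  •-δ n = ax (D1 n _) , ax (D2 n _)

  δ-summable : ∀ n .{{_ : NonZero n}} → Summable n (δ n φ)
  δ-summable n = summable n (~~-intro ⨾ ax (D3 n _))

  -- The laws of `δ` below follow from this by exhibiting a summable formula with the right `n`-fold
  -- sum.
  δ-unique : ∀ n .{{_ : NonZero n}} → Summable n ψ → n • ψ ≈ φ → ψ ≈ δ n φ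
  δ-unique n s p = •-cancel n s (δ-summable n) (≈-trans p (≈-sym (•-δ n)))

  δ-cong : ∀ n .{{_ : NonZero n}} → φ ≈ ψ → δ n φ ≈ δ n ψ
  δ-cong n p = δ-unique n (δ-summable n) (≈-trans (•-δ n) p)

  δ-⊖ : ∀ n .{{_ : NonZero n}} → δ n (~ (φ ⇒ ψ)) ≈ ~ (δ n φ ⇒ δ n ψ)
  δ-⊖ n = ≈-sym (δ-unique n (Summable-mono ⊖-⊑ (δ-summable n))
    (≈-trans (•-⊖ n (δ-summable n)) (~-cong (⇒-cong (•-δ n) (•-δ n)))))

  -- The equation for `M` is an argument so that the same `δ (n * N) φ` can refine both `δ n φ` and
  -- `δ N φ`.
  δ-refine : ∀ n N {M} .{{_ : NonZero n}} .{{_ : NonZero M}} →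
    M ≡ n * N → N • δ M φ ≈ δ n φ
  δ-refine n N {M} refl = δ-unique n (Summable-• N n (δ-summable M))
    (≈-trans (≈-sym (•-* n N)) (•-δ M))

  δ-• : ∀ n m N .{{_ : NonZero n}} .{{_ : NonZero N}} .{{_ : NonZero (n * N)}} →
    m ≤ N → δ n (m • δ N φ) ≈ m • δ (n * N) φ
  δ-• {φ} n m N m≤N = ≈-sym (δ-unique n
    (Summable-• m n (Summable-≤ (ℕₚ.*-monoʳ-≤ n m≤N) (δ-summable (n * N)))) (begin
      n • (m • δ (n * N) φ)   ≈⟨ •-* n m ⟨
      (n * m) • δ (n * N) φ   ≡⟨ cong (_• δ (n * N) φ) (ℕₚ.*-comm n m) ⟩
      (m * n) • δ (n * N) φ   ≈⟨ •-* m n ⟩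
      m • (n • δ (n * N) φ)   ≈⟨ •-cong m (δ-refine N n (ℕₚ.*-comm n N)) ⟩
      m • δ N φ               ∎))
    where open ≈-Reasoning

  δ-fraction : ∀ {m a} n N .{{_ : NonZero n}} .{{_ : NonZero N}} →
    m * N ≡ a * n → m • δ n φ ≈ a • δ N φ
  δ-fraction {φ} {m} {a} n N eq = begin
    m • δ n φ               ≈⟨ •-cong m (δ-refine n N refl) ⟨
    m • (N • δ (n * N) φ)   ≈⟨ •-* m N ⟨
    (m * N) • δ (n * N) φ   ≡⟨ cong (_• δ (n * N) φ) eq ⟩
    (a * n) • δ (n * N) φ   ≈⟨ •-* a n ⟩
    a • (n • δ (n * N) φ)   ≈⟨ •-cong a (δ-refine N n (ℕₚ.*-comm n N)) ⟩
    a • δ N φ               ∎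
    where
    open ≈-Reasoning
    instance
      nN≢0 = ℕₚ.m*n≢0 n N

  -- Interpretation of `∇` and soundness of `I₂`

  module _ (rep : Representation) where

    open Representation rep

    Δ′ : [0,1]ℚ → FormRat → FormRat
    Δ′ r φ = num r • δ (den r) φ

    Δ′-cong : ∀ r → φ ≈ ψ → Δ′ r φ ≈ Δ′ r ψ
    Δ′-cong r p = •-cong (num r) (δ-cong (den r) p)

    -- Makes the interpretation independent of the fraction chosen by `rep`.
    Δ′-fraction : ∀ r a n .{{_ : NonZero n}} → value r ≡ + a / n → Δ′ r φ ≈ a • δ n φ
    Δ′-fraction r a n eq = δ-fraction (den r) n (/-cross (num r) a (den r) n (trans (represents r) eq))

    Δ′-⊖ : ∀ r → Δ′ r (~ (φ ⇒ ψ)) ≈ ~ (Δ′ r φ ⇒ Δ′ r ψ)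
    Δ′-⊖ r = ≈-trans (•-cong (num r) (δ-⊖ (den r)))
      (•-⊖ (num r) (Summable-≤ (num≤den r) (δ-summable (den r))))

    Δ′-⊙ : ∀ r q → Δ′ (r ⊙ q *) φ ≈ ~ (Δ′ r φ ⇒ Δ′ q φ)
    Δ′-⊙ {φ} r q = begin
      Δ′ (r ⊙ q *) φ                     ≈⟨ Δ′-fraction (r ⊙ q *) (a ∸ b) N (⊙-/ r q a b N r≡ q≡) ⟩
      (a ∸ b) • δ N φ                    ≈⟨ ∸-• a b (ℕₚ.*-monoˡ-≤ (den q) (num≤den r)) (δ-summable N) ⟩
      ~ (a • δ N φ ⇒ b • δ N φ)          ≈⟨ ~-cong (⇒-cong (Δ′-fraction r a N r≡) (Δ′-fraction q b N q≡)) ⟨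
      ~ (Δ′ r φ ⇒ Δ′ q φ)                ∎
      where
      open ≈-Reasoning
      -- A common denominator, with `a` and `b` the numerators of `r` and `q` over it.
      N = den r * den q
      a = num r * den q
      b = den r * num q
      instance
        N≢0 = ℕₚ.m*n≢0 (den r) (den q)
      r≡ : value r ≡ + a / N
      r≡ = trans (sym (represents r)) (cross-/ (num r) a (den r) N
        (trans (cong (num r *_) (ℕₚ.*-comm (den r) (den q))) (sym (ℕₚ.*-assoc (num r) (den q) (den r)))))
      q≡ : value q ≡ + b / N
      q≡ = trans (sym (represents q)) (cross-/ (num q) b (den q) N
        (trans (sym (ℕₚ.*-assoc (num q) (den r) (den q))) (cong (_* den q) (ℕₚ.*-comm (num q) (den r)))))

    Δ′-· : ∀ r q → Δ′ r (Δ′ q φ) ≈ Δ′ (r · q) φ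
    Δ′-· {φ} r q = begin
      num r • δ (den r) (num q • δ (den q) φ)   ≈⟨ •-cong (num r) (δ-• (den r) (num q) (den q) (num≤den q)) ⟩
      num r • (num q • δ N φ)                   ≈⟨ •-* (num r) (num q) ⟨
      (num r * num q) • δ N φ                   ≈⟨ Δ′-fraction (r · q) (num r * num q) N r·q≡ ⟨
      Δ′ (r · q) φ                              ∎
      where
      open ≈-Reasoning
      N = den r * den q
      instance
        N≢0 = ℕₚ.m*n≢0 (den r) (den q)
      r·q≡ : value (r · q) ≡ + (num r * num q) / N
      r·q≡ = sym (trans (/-* (num r) (num q) (den r) (den q))
        (cong₂ ℚ._*_ (represents r) (represents q)))

    Δ′-one : Δ′ 1ᵘ φ ≈ φ
    Δ′-one = ≈-trans (Δ′-fraction 1ᵘ 1 1 refl) (•-δ 1)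

    -- The image of `∇ᐞ` under `I₂`; the four equivalences that follow are Q1 to Q4 for it.
    ∇′ : [0,1]ℚ → FormRat → FormRat
    ∇′ r φ = ~ Δ′ r (~ φ)

    ∇′-⇒ : ∀ r → ∇′ r (φ ⇒ ψ) ≈ (∇′ r φ ⇒ ∇′ r ψ)
    ∇′-⇒ {φ} {ψ} r = begin
      -- Contraposition turns the argument of `Δ′ r` into the difference of `~ ψ` and `~ φ`, so that
      -- `Δ′-⊖` applies.
      ~ Δ′ r (~ (φ ⇒ ψ))              ≈⟨ ~-cong (Δ′-cong r (~-cong contraposition-≈)) ⟨
      ~ Δ′ r (~ (~ ψ ⇒ ~ φ))          ≈⟨ ~-cong (Δ′-⊖ r) ⟩
      ~ ~ (Δ′ r (~ ψ) ⇒ Δ′ r (~ φ))   ≈⟨ ~~-≈ ⟩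
      (Δ′ r (~ ψ) ⇒ Δ′ r (~ φ))       ≈⟨ contraposition-≈ ⟨
      (∇′ r φ ⇒ ∇′ r ψ)               ∎
      where open ≈-Reasoning

    ∇′-⊙ : ∀ r q → ∇′ (r ⊙ q *) φ ≈ (∇′ q φ ⇒ ∇′ r φ)
    ∇′-⊙ r q = ≈-trans (~-cong (Δ′-⊙ r q)) (≈-trans ~~-≈ (≈-sym contraposition-≈))

    ∇′-· : ∀ r q → ∇′ r (∇′ q φ) ≈ ∇′ (r · q) φ
    ∇′-· r q = ~-cong (≈-trans (Δ′-cong r ~~-≈) (Δ′-· r q))

    ∇′-one : ∇′ 1ᵘ φ ≈ φ
    ∇′-one = ≈-trans (~-cong Δ′-one) ~~-≈

    sound : ∀ {ψ} → ⊢𝒬 ψ → ⊢Rat I₂ rep (unfold∇ ψ)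
    sound (L1 φ ψ)          = L1 _ _
    sound (L2 φ ψ χ)        = L2 _ _ _
    sound (L3 φ ψ)          = L3 _ _
    sound (L4 φ ψ)          = L4 _ _
    sound (mp p q)          = mp (sound p) (sound q)
    sound (ax (Q1→ r φ ψ))  = to (∇′-⇒ r)
    sound (ax (Q1← r φ ψ))  = from (∇′-⇒ r)
    sound (ax (Q2→ r q φ))  = to (∇′-⊙ r q)
    sound (ax (Q2← r q φ))  = from (∇′-⊙ r q)
    sound (ax (Q3→ r q φ))  = to (∇′-· r q)
    sound (ax (Q3← r q φ))  = from (∇′-· r q)
    sound (ax (Q4→ φ))      = to ∇′-one
    sound (ax (Q4← φ))      = from ∇′-one

    -- The round trip only inserts double negations around and under each `Δ`; congruence of `Δ′ r`
    -- removes the inner ones.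
    I₂-unfold∇-unfoldΔ : ∀ ψ → I₂ rep (unfold∇ (unfoldΔ ψ)) ≈ I₂ rep ψ
    I₂-unfold∇-unfoldΔ (var i)          = ≈-refl
    I₂-unfold∇-unfoldΔ (~ ψ)            = ~-cong (I₂-unfold∇-unfoldΔ ψ)
    I₂-unfold∇-unfoldΔ (φ ⇒ ψ)          = ⇒-cong (I₂-unfold∇-unfoldΔ φ) (I₂-unfold∇-unfoldΔ ψ)
    I₂-unfold∇-unfoldΔ (op (delta r) ψ) =
      ≈-trans ~~-≈ (Δ′-cong r (≈-trans ~~-≈ (I₂-unfold∇-unfoldΔ ψ)))

    I₂-I₁ : ∀ φ → I₂ rep (I₁ φ) ≈ φ
    I₂-I₁ (var i)             = ≈-refl
    I₂-I₁ (~ φ)               = ~-cong (I₂-I₁ φ)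
    I₂-I₁ (φ ⇒ ψ)             = ⇒-cong (I₂-I₁ φ) (I₂-I₁ ψ)
    I₂-I₁ (op (division n) φ) =
      ≈-trans (Δ′-fraction (1/ₙ n) 1 n refl) (δ-cong n (I₂-I₁ φ))

theorem2p5 : (rep : Representation) →
    ((φ : FormRat) → (⊢Rat φ) ⇔ (⊢𝒬ᐞ I₁ φ))
    × ((ψ : Form𝒬ᐞ) → (⊢𝒬ᐞ ψ) ⇔ (⊢Rat I₂ rep ψ))
    × ((ψ : Form𝒬) → (⊢𝒬 ψ) ⇔ (⊢Rat I₂ rep (unfold∇ ψ)))
theorem2p5 rep =
  -- For the converse, `I₂` carries the theorem `I₁ φ` back to `I₂ rep (I₁ φ)`, which is equivalent
  -- to `φ`.
  (λ φ → mk⇔ 𝒬Ł.sound (λ p → mp (reflect (I₁ φ) p) (Rat.to (Rat.I₂-I₁ rep φ)))) ,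
  (λ ψ → mk⇔ (reflect ψ) (preserve ψ)) ,
  (λ ψ → mk⇔ (Rat.sound rep) (λ p → mp (preserve (unfold∇ ψ) p) (𝒬Ł.to (𝒬Ł.unfoldΔ-unfold∇ ψ))))
  where
  reflect : ∀ ψ → ⊢𝒬ᐞ ψ → ⊢Rat I₂ rep ψ
  reflect ψ p = mp (Rat.sound rep p) (Rat.to (Rat.I₂-unfold∇-unfoldΔ rep ψ))
  preserve : ∀ ψ → ⊢Rat I₂ rep ψ → ⊢𝒬ᐞ ψ
  preserve ψ p = mp (𝒬Ł.sound p) (𝒬Ł.to (I₁-I₂ rep ψ))
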